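{- Monitor-triggered temporal logic is strictly more expressive than LTL: for every LTL formula $\phi$ over ${\cal P}$ there is a monitor-triggered formula satisfied by exactly the same infinite traces over $2^{\cal P}$, and there is a monitor-triggered formula whose set of satisfying infinite traces is not the set of satisfying traces of any LTL formula.
   Context: Let ${\cal P}={\cal P}_{in}\cup{\cal P}_{out}$ be a set of propositions. Infinite traces $\sigma=\sigma_0\sigma_1\cdots$ have letters $\sigma_i\subseteq{\cal P}$; $\sigma_{i,j}=\sigma_i\cdots\sigma_j$ and $\sigma_{i,\infty}$ is the suffix from $i$. LTL: $\phi ::= \mathit{tt}\mid\mathit{ff}\mid e\mid\neg e\mid\phi\wedge\phi\mid\phi\vee\phi\mid X\phi\mid\phi U\phi\mid G\phi$ with the standard infinite-trace semantics. Co-safety LTL: the fragment without $G$. Finite-trace semantics of co-safety formulas on $\sigma_{i,j}$ ($j<\infty$): atoms and Boolean connectives evaluated at position $i$ as usual; $\sigma_{i,j}\vdash X\varphi$ iff $j>i$ and $\sigma_{i+1,j}\vdash\varphi$; $\sigma_{i,j}\vdash\varphi U\psi$ iff some $l\in[i,j]$ has $\sigma_{l,j}\vdash\psi$ and $\sigma_{k,j}\vdash\varphi$ for all $k\in[i,l)$. Tight satisfaction $\sigma_{i,j}\Vdash\varphi$: $\sigma_{i,j}\vdash\varphi$ and no $\sigma_{i,k}$ with $i\le k<j$ satisfies $\varphi$. Flagging monitor over $\Sigma=2^{{\cal P}_{in}}$: a tuple $D=\langle \Sigma, \mathbb{V}, \Theta, Q, \theta_0, q_0, F, \perp, \rightarrow\rangle$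 with typed variables $\mathbb{V}$ (arbitrary domains), valuations $\Theta$, finite states $Q$, initial valuation $\theta_0$, initial state $q_0$, flagging states $F\subseteq Q\setminus\{q_0\}$, sink $\perp$, and deterministic transitions $q\xrightarrow{g\mapsto a}q'$ ($q\ne\perp$) with guards $g:\Sigma\times\Theta\to\{\mathit{true},\mathit{false}\}$ and actions $a:\Sigma\times\Theta\to\Theta$. Semantics on configurations $(q,\theta)$ reading $E$: (1) if $q\notin F\cup\{\perp\}$ and a transition from $q$ has true guard, take it and set the valuation to $a(E,\theta)$; (2) if $q\notin F\cup\{\perp\}$ and no guard holds, stay; (3) $\perp$ stays; (4) a state of $F$ moves to $\perp$. On a trace over $2^{\cal P}$ the monitor reads the events $\sigma_i\cap{\cal P}_{in}$. $\sigma_{i,j}\Vdash D$ iff the run from $(q_0,\theta_0)$ on $\sigma_i,\dots,\sigma_j$ ends in a state of $F$. Monitor-triggered formulas: $\pi' ::= D{:}\phi\mid(D;\varphi)^*$ and $\pi ::= \phi\rightarrow\pi'$, with $D$ a monitor, $\phi$ LTL, $\varphi$ co-safety LTL. Semantics: $\sigma_{i,\infty}\vdash D{:}\phi$ iff for all $j\ge i$, $\sigma_{i,j}\Vdash D$ implies $\sigma_{j,\infty}\vdash\phi$. $\sigma_{i,k}\vdash D;\varphi$ iff there is $j\in[i,k]$ with $\sigma_{i,j}\Vdash D$ and $\sigma_{j,k}\Vdash\varphi$. Define restart points of $\sigma$: $0$ is one, and if $p$ is one and $\sigma_{p,k}\vdash D;\varphi$ then $k+1$ is one. $\sigma\vdash(D;\varphi)^*$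 iff for every restart point $p$ and every $i\ge p$ with $\sigma_{p,i}\Vdash D$ there is $k\ge i$ with $\sigma_{p,k}\vdash D;\varphi$. $\sigma\vdash\phi\rightarrow\pi'$ iff $\sigma\vdash\phi$ implies $\sigma\vdash\pi'$. $\sigma\vdash\pi'$ means $\sigma_{0,\infty}\vdash\pi'$. -}

module Defs where

open import Data.Bool using (Bool; true; false; T)
open import Data.Empty using (⊥)
open import Data.Fin using (Fin)
open import Data.Nat using (ℕ; zero; suc; _≤_; _<_)
open import Data.Product using (Σ; ∃; _×_; _,_; proj₁; proj₂)
open import Data.Sum using (_⊎_)
open import Data.Unit using (⊤)
open import Function.Bundles using (_↔_)
open import Relation.Binary.PropositionalEquality using (_≡_; _≢_)
open import Relation.Nullary using (¬_)

-- 2^A, by characteristic functions.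
𝒫 : Set → Set
𝒫 A = A → Bool

infix 4 _∈_ _∉_

_∈_ _∉_ : {A : Set} → A → 𝒫 A → Set
x ∈ S = T (S x)
x ∉ S = ¬ (x ∈ S)

-- P = Pin ∪ Pout; neither disjointness nor finiteness is assumed.
record Propositions : Set₁ where
  field
    P     : Set
    Pin   : 𝒫 P
    Pout  : 𝒫 P
    cover : ∀ p → p ∈ Pin ⊎ p ∈ Pout

module _ (AP : Propositions) where
  open Propositions AP

  Letter : Set
  Letter = 𝒫 P

  Trace : Set
  Trace = ℕ → Letter

  Event : Set
  Event = 𝒫 (Σ P (_∈ Pin))

  -- a ∩ Pin, as a subset of Pin.
  input : Letter → Event
  input a (p , _) = a p

  infixr 6 _∧_
  infixr 5 _∨_
  infixr 7 _U_

  data LTL : Set where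
    tt ff   : LTL
    atom    : P → LTL
    ¬atom   : P → LTL
    _∧_ _∨_ : LTL → LTL → LTL
    X       : LTL → LTL
    _U_     : LTL → LTL → LTL
    G       : LTL → LTL

  GFree : LTL → Set
  GFree tt        = ⊤
  GFree ff        = ⊤
  GFree (atom e)  = ⊤
  GFree (¬atom e) = ⊤
  GFree (φ ∧ ψ)   = GFree φ × GFree ψ
  GFree (φ ∨ ψ)   = GFree φ × GFree ψ
  GFree (X φ)     = GFree φ
  GFree (φ U ψ)   = GFree φ × GFree ψ
  GFree (G φ)     = ⊥

  CoSafety : Set
  CoSafety = Σ LTL GFree

  record Monitor : Set₁ where
    field
      Var : Set
      Dom : Var → Set

    Θ : Set
    Θ = (v : Var) → Dom v

    Guard : Set
    Guard = Event → Θ → Bool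

    Action : Set
    Action = Event → Θ → Θ

    field
      Q        : Set
      Q-finite : ∃ λ n → Q ↔ Fin n
      θ₀       : Θ
      q₀       : Q
      F        : 𝒫 Q
      q₀∉F     : q₀ ∉ F
      sink     : Q
      _—[_↦_]→_ : Q → Guard → Action → Q → Set
      source≢sink : ∀ {q g a q′} → q —[ g ↦ a ]→ q′ → q ≢ sink
      -- At most one transition from q is enabled at a time.
      deterministic : ∀ {q g₁ a₁ q₁ g₂ a₂ q₂} →
        q —[ g₁ ↦ a₁ ]→ q₁ → q —[ g₂ ↦ a₂ ]→ q₂ →
        ∀ E θ → g₁ E θ ≡ true → g₂ E θ ≡ true →
        g₁ ≡ g₂ × a₁ ≡ a₂ × q₁ ≡ q₂

    Config : Set
    Config = Q × Θ

    data Step (E : Event) : Config → Config → Set where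
      fire : ∀ {q θ g a q′} → q ∉ F → q ≢ sink →
             q —[ g ↦ a ]→ q′ → g E θ ≡ true →
             Step E (q , θ) (q′ , a E θ)
      stay : ∀ {q θ} → q ∉ F → q ≢ sink →
             (∀ {g a q′} → q —[ g ↦ a ]→ q′ → g E θ ≡ false) →
             Step E (q , θ) (q , θ)
      sunk : ∀ {θ} → Step E (sink , θ) (sink , θ)
      drop : ∀ {q θ} → q ∈ F → Step E (q , θ) (sink , θ)

    -- Run σ i n c : c is reached from (q₀ , θ₀) by reading the letters of σ
    -- at the positions i, …, n - 1.
    data Run (σ : Trace) (i : ℕ) : ℕ → Config → Set where
      start : Run σ i i (q₀ , θ₀)
      read  : ∀ {n c c′} → Run σ i n c → Step (input (σ n)) c c′ →
              Run σ i (suc n) c′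

  infix 7 _∶_
  infix 6 _⇒_

  data Triggered : Set₁ where
    _∶_   : Monitor → LTL → Triggered
    ⟨_⨾_⟩* : Monitor → CoSafety → Triggered

  data MTFormula : Set₁ where
    _⇒_ : LTL → Triggered → MTFormula

module _ {AP : Propositions} where

  infix 4 _[_,∞]⊢_ _[_,∞]⊢ᵀ_∶_ _[_,_]⊢_ _[_,_]⊩_ _[_,_]⊩ᴹ_ _[_,_]⊢_⨾_ _⊢_ _⊢′_ _⊢ᴹ_

  -- σ [ i ,∞]⊢ φ is satisfaction of φ by the suffix of σ from position i.
  _[_,∞]⊢_ : Trace AP → ℕ → LTL AP → Set
  σ [ i ,∞]⊢ tt      = ⊤
  σ [ i ,∞]⊢ ff      = ⊥
  σ [ i ,∞]⊢ atom e  = e ∈ σ i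
  σ [ i ,∞]⊢ ¬atom e = e ∉ σ i
  σ [ i ,∞]⊢ φ ∧ ψ   = (σ [ i ,∞]⊢ φ) × (σ [ i ,∞]⊢ ψ)
  σ [ i ,∞]⊢ φ ∨ ψ   = (σ [ i ,∞]⊢ φ) ⊎ (σ [ i ,∞]⊢ ψ)
  σ [ i ,∞]⊢ X φ     = σ [ suc i ,∞]⊢ φ
  σ [ i ,∞]⊢ φ U ψ   = ∃ λ l → i ≤ l × (σ [ l ,∞]⊢ ψ) ×
                         (∀ k → i ≤ k → k < l → σ [ k ,∞]⊢ φ)
  σ [ i ,∞]⊢ G φ     = ∀ k → i ≤ k → σ [ k ,∞]⊢ φ

  -- Only meaningful for i ≤ j; every use below ensures this.
  _[_,_]⊢_ : Trace AP → ℕ → ℕ → CoSafety AP → Set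
  σ [ i , j ]⊢ (tt , _)            = ⊤
  σ [ i , j ]⊢ (ff , _)            = ⊥
  σ [ i , j ]⊢ (atom e , _)        = e ∈ σ i
  σ [ i , j ]⊢ (¬atom e , _)       = e ∉ σ i
  σ [ i , j ]⊢ (φ ∧ ψ , f , g)     = (σ [ i , j ]⊢ (φ , f)) × (σ [ i , j ]⊢ (ψ , g))
  σ [ i , j ]⊢ (φ ∨ ψ , f , g)     = (σ [ i , j ]⊢ (φ , f)) ⊎ (σ [ i , j ]⊢ (ψ , g))
  σ [ i , j ]⊢ (X φ , f)           = i < j × (σ [ suc i , j ]⊢ (φ , f))
  σ [ i , j ]⊢ (φ U ψ , f , g)     = ∃ λ l → i ≤ l × l ≤ j × (σ [ l , j ]⊢ (ψ , g)) ×
                                       (∀ k → i ≤ k → k < l → σ [ k , j ]⊢ (φ , f))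

  _[_,_]⊩_ : Trace AP → ℕ → ℕ → CoSafety AP → Set
  σ [ i , j ]⊩ φ = (σ [ i , j ]⊢ φ) × (∀ k → i ≤ k → k < j → ¬ (σ [ i , k ]⊢ φ))

  _[_,_]⊩ᴹ_ : Trace AP → ℕ → ℕ → Monitor AP → Set
  σ [ i , j ]⊩ᴹ D = i ≤ j × (∃ λ c → Run σ i (suc j) c × proj₁ c ∈ F)
    where open Monitor D

  _[_,∞]⊢ᵀ_∶_ : Trace AP → ℕ → Monitor AP → LTL AP → Set
  σ [ i ,∞]⊢ᵀ D ∶ φ = ∀ j → i ≤ j → σ [ i , j ]⊩ᴹ D → σ [ j ,∞]⊢ φ

  _[_,_]⊢_⨾_ : Trace AP → ℕ → ℕ → Monitor AP → CoSafety AP → Set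
  σ [ i , k ]⊢ D ⨾ φ = ∃ λ j → i ≤ j × j ≤ k × (σ [ i , j ]⊩ᴹ D) × (σ [ j , k ]⊩ φ)

  data Restart (D : Monitor AP) (φ : CoSafety AP) (σ : Trace AP) : ℕ → Set where
    origin : Restart D φ σ 0
    again  : ∀ {p k} → Restart D φ σ p → σ [ p , k ]⊢ D ⨾ φ → Restart D φ σ (suc k)

  _⊢_ : Trace AP → LTL AP → Set
  σ ⊢ φ = σ [ 0 ,∞]⊢ φ

  _⊢′_ : Trace AP → Triggered AP → Set
  σ ⊢′ (D ∶ φ)     = σ [ 0 ,∞]⊢ᵀ D ∶ φ
  σ ⊢′ ⟨ D ⨾ φ ⟩* = ∀ p → Restart D φ σ p →
                     ∀ i → p ≤ i → σ [ p , i ]⊩ᴹ D →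
                     ∃ λ k → i ≤ k × (σ [ p , k ]⊢ D ⨾ φ)

  _⊢ᴹ_ : Trace AP → MTFormula AP → Set
  σ ⊢ᴹ (φ ⇒ π′) = σ ⊢ φ → σ ⊢′ π′

{-# OPTIONS --safe #-}
-- An LTL formula φ is equivalent to D ∶ φ, where D flags right after its first
-- letter.  For strictness, with the same D, the restart points of
-- ⟨ D ⨾ (e ∧ X tt) ⟩* are the even positions as long as e holds there, so the
-- formula says that e holds at every even position.  No LTL formula says this
-- (Wolper): on traces that omit e at exactly one position n, a formula whose
-- nesting depth of X is less than n cannot distinguish n from n + 1.
module Submission where

open import Defs
open import Data.Bool using (Bool; true; false; not)
open import Data.Empty using (⊥)
open import Data.Fin using (Fin; zero; suc)
open import Data.Nat using (ℕ; zero; suc; _*_; _⊔_; _≤_; z≤n; s≤s; _≡ᵇ_)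
open import Data.Nat.Properties using (≤-refl; ≤-antisym; ≮⇒≥; <⇒≱; n≤1+n; m≤m*n; m⊔n≤o⇒m≤o; m⊔n≤o⇒n≤o)
open import Data.Product using (∃; _×_; _,_; proj₁)
open import Data.Product.Function.NonDependent.Propositional using (_×-⇔_)
open import Data.Sum.Function.Propositional using (_⊎-⇔_)
open import Data.Unit using (tt)
open import Function.Base using (id; _∘_)
open import Function.Bundles using (_⇔_; mk⇔; module Equivalence)
open import Function.Construct.Identity using (⇔-id; ↔-id)
open import Relation.Binary.PropositionalEquality using (_≡_; refl)
open import Relation.Nullary using (¬_; contradiction)

open Equivalence using (to; from)

module _ {AP : Propositions} where
  open Propositions AP

  pattern initial = zero
  pattern flag    = suc zero
  pattern halt    = suc (suc zero)

  -- The one valuation over no variables, spelled out because `Flag` is indexed by guards and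
  -- actions before `flagFirst` exists.
  Valuation : Set
  Valuation = ⊥ → ⊥

  data Flag : Fin 3 → (Event AP → Valuation → Bool) →
              (Event AP → Valuation → Valuation) → Fin 3 → Set where
    go : Flag initial (λ _ _ → true) (λ _ → id) flag

  flagFirst : Monitor AP
  flagFirst = record
    { Var           = ⊥
    ; Dom           = λ _ → ⊥
    ; Q             = Fin 3
    ; Q-finite      = 3 , ↔-id _
    ; θ₀            = id
    ; q₀            = initial
    ; F             = λ { flag → true ; _ → false }
    ; q₀∉F          = λ ()
    ; sink          = halt
    ; _—[_↦_]→_     = Flag
    ; source≢sink   = λ { go () }
    ; deterministic = λ { go go _ _ _ _ → refl , refl , refl }
    }

  open Monitor flagFirst using (Config; Run; start; read; Step; fire; stay; sunk; drop)

  -- Run invariant tying state to time. The only guard is always true, so `initial` survives no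
  -- letter, and `flag` drops to `halt` after one more.
  data Stage (i : ℕ) : ℕ → Config → Set where
    unread  : ∀ {θ} → Stage i i (initial , θ)
    flagged : ∀ {θ} → Stage i (suc i) (flag , θ)
    halted  : ∀ {n θ} → Stage i n (halt , θ)

  stage-step : ∀ {E i n c c′} → Stage i n c → Step E c c′ → Stage i (suc n) c′
  stage-step unread  (fire _ _ go _)   = flagged
  stage-step unread  (stay _ _ closed) = contradiction (closed go) λ ()
  stage-step flagged (fire _ _ () _)
  stage-step flagged (stay ∉F _ _)     = contradiction tt ∉F
  stage-step flagged (drop _)          = halted
  stage-step halted  (stay _ ≢halt _)  = contradiction refl ≢halt
  stage-step halted  sunk              = halted
  stage-step halted  (drop ())

  stage : ∀ {σ i n c} → Run σ i n c → Stage i n c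
  stage start      = unread
  stage (read r s) = stage-step (stage r) s

  flagFirst-flags : ∀ {σ : Trace AP} {i} → σ [ i , i ]⊩ᴹ flagFirst
  flagFirst-flags = ≤-refl , _ , read start (fire (λ ()) (λ ()) go refl) , tt

  flagFirst-only : ∀ {σ : Trace AP} {i j} → σ [ i , j ]⊩ᴹ flagFirst → i ≡ j
  flagFirst-only (_ , _ , r , ∈F) with stage r
  ... | flagged = refl
  ... | unread  = contradiction ∈F λ ()
  ... | halted  = contradiction ∈F λ ()

  embed : LTL AP → MTFormula AP
  embed φ = tt ⇒ flagFirst ∶ φ

  embed-⇔ : ∀ (φ : LTL AP) (σ : Trace AP) → (σ ⊢ᴹ embed φ) ⇔ (σ ⊢ φ)
  embed-⇔ φ σ = mk⇔
    (λ h → h tt 0 z≤n (flagFirst-flags {σ}))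
    (λ h _ j _ f → at j (flagFirst-only f) h)
    where
    at : ∀ j → 0 ≡ j → σ ⊢ φ → σ [ j ,∞]⊢ φ
    at _ refl = id

  -- The conjunct `X tt` stretches the tight segment to two letters, so that the next block starts
  -- two positions later rather than one.
  nowThenNext : P → CoSafety AP
  nowThenNext e = atom e ∧ X tt , tt , tt

  nowThenNext-tight : ∀ {e σ j} → e ∈ σ j → σ [ j , suc j ]⊩ nowThenNext e
  nowThenNext-tight e∈ = (e∈ , ≤-refl , tt) ,
    λ { _ _ (s≤s k≤j) (_ , j<k , _) → <⇒≱ j<k k≤j }

  nowThenNext-end : ∀ {e σ j k} → σ [ j , k ]⊩ nowThenNext e → k ≡ suc j
  nowThenNext-end {j = j} ((e∈ , j<k , _) , minimal) = ≤-antisym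
    (≮⇒≥ λ 1+j<k → minimal (suc j) (n≤1+n j) 1+j<k (e∈ , ≤-refl , tt))
    j<k

  evenly : P → MTFormula AP
  evenly e = tt ⇒ ⟨ flagFirst ⨾ nowThenNext e ⟩*

  block : ∀ {e σ r} → e ∈ σ r → σ [ r , suc r ]⊢ flagFirst ⨾ nowThenNext e
  block {σ = σ} {r} e∈ =
    r , ≤-refl , n≤1+n r , flagFirst-flags {σ} , nowThenNext-tight {σ = σ} e∈

  block⁻¹ : ∀ {e σ r k} → σ [ r , k ]⊢ flagFirst ⨾ nowThenNext e → e ∈ σ r × k ≡ suc r
  block⁻¹ {σ = σ} (j , _ , _ , f , t) with refl ← flagFirst-only f =
    proj₁ (proj₁ t) , nowThenNext-end {σ = σ} t

  -- A block from `r` ends at `suc r`, so the next restart point is `suc (suc r)`. With `m * 2`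
  -- rather than `2 * m`, this is `suc m * 2` by computation.
  restart-even : ∀ {e σ r} → Restart flagFirst (nowThenNext e) σ r → ∃ λ m → r ≡ m * 2
  restart-even origin = 0 , refl
  restart-even {e} {σ} (again ρ b)
    with m , refl ← restart-even ρ
       | _ , refl ← block⁻¹ {e} {σ} b = suc m , refl

  evenly-⇔ : ∀ e σ → (σ ⊢ᴹ evenly e) ⇔ (∀ m → e ∈ σ (m * 2))
  evenly-⇔ e σ = mk⇔ (λ h m → holds h (restarts h m)) back
    where
    holds : ∀ {r} → σ ⊢ᴹ evenly e → Restart flagFirst (nowThenNext e) σ r → e ∈ σ r
    holds h ρ with _ , _ , b ← h tt _ ρ _ ≤-refl (flagFirst-flags {σ}) =
      proj₁ (block⁻¹ {e} {σ} b)

    restarts : σ ⊢ᴹ evenly e → ∀ m → Restart flagFirst (nowThenNext e) σ (m * 2)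
    restarts h zero    = origin
    -- The monitor flags at once at a restart point, so the formula forces a block there; hence `e`
    -- holds and the block leads to the next even position.
    restarts h (suc m) = again (restarts h m) (block {e} {σ} (holds h (restarts h m)))

    back : (∀ m → e ∈ σ (m * 2)) → σ ⊢ᴹ evenly e
    back h _ r ρ i _ f
      with m , refl ← restart-even ρ
         | refl ← flagFirst-only f =
      suc r , n≤1+n r , block {e} {σ} (h m)

  -- LTL looks only forward, so the first letter is irrelevant from position 1 on.
  shift : ∀ (φ : LTL AP) (σ : Trace AP) i → (σ [ suc i ,∞]⊢ φ) ⇔ ((σ ∘ suc) [ i ,∞]⊢ φ)
  shift tt        σ i = ⇔-id _
  shift ff        σ i = ⇔-id _
  shift (atom e)  σ i = ⇔-id _
  shift (¬atom e) σ i = ⇔-id _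
  shift (φ ∧ ψ)   σ i = shift φ σ i ×-⇔ shift ψ σ i
  shift (φ ∨ ψ)   σ i = shift φ σ i ⊎-⇔ shift ψ σ i
  shift (X φ)     σ i = shift φ σ (suc i)
  shift (φ U ψ)   σ i = mk⇔
    (λ { (suc l , s≤s i≤l , hψ , hφ) → l , i≤l , to (shift ψ σ l) hψ ,
         λ k i≤k k<l → to (shift φ σ k) (hφ (suc k) (s≤s i≤k) (s≤s k<l)) })
    (λ { (l , i≤l , hψ , hφ) → suc l , s≤s i≤l , from (shift ψ σ l) hψ ,
         λ { (suc k) (s≤s i≤k) (s≤s k<l) → from (shift φ σ k) (hφ k i≤k k<l) } })
  shift (G φ)     σ i = mk⇔
    (λ h k i≤k → to (shift φ σ k) (h (suc k) (s≤s i≤k)))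
    (λ { h (suc k) (s≤s i≤k) → from (shift φ σ k) (h k i≤k) })

  X-depth : LTL AP → ℕ
  X-depth tt        = 0
  X-depth ff        = 0
  X-depth (atom e)  = 0
  X-depth (¬atom e) = 0
  X-depth (φ ∧ ψ)   = X-depth φ ⊔ X-depth ψ
  X-depth (φ ∨ ψ)   = X-depth φ ⊔ X-depth ψ
  X-depth (X φ)     = suc (X-depth φ)
  X-depth (φ U ψ)   = X-depth φ ⊔ X-depth ψ
  X-depth (G φ)     = X-depth φ

  -- All propositions fail together at `n`, so no equality test on `P` is needed. By computation of
  -- `≡ᵇ`, dropping the first letter of `gap (suc n)` yields `gap n`.
  gap : ℕ → Trace AP
  gap n i _ = not (n ≡ᵇ i)

  gap-shift : ∀ (φ : LTL AP) n i → (gap (suc n) [ suc i ,∞]⊢ φ) ⇔ (gap n [ i ,∞]⊢ φ)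
  gap-shift φ n i = shift φ (gap (suc n)) i

  -- For U and G, both traces satisfy the same subformulas at position 0, and
  -- the rest of the longer one is the whole of the shorter one.
  gap-stutter : ∀ (φ : LTL AP) {n} → X-depth φ ≤ n → (gap (suc n) ⊢ φ) ⇔ (gap (suc (suc n)) ⊢ φ)
  gap-stutter tt        _ = ⇔-id _
  gap-stutter ff        _ = ⇔-id _
  gap-stutter (atom e)  _ = ⇔-id _
  gap-stutter (¬atom e) _ = ⇔-id _
  gap-stutter (φ ∧ ψ)   d = gap-stutter φ (m⊔n≤o⇒m≤o _ _ d) ×-⇔ gap-stutter ψ (m⊔n≤o⇒n≤o _ _ d)
  gap-stutter (φ ∨ ψ)   d = gap-stutter φ (m⊔n≤o⇒m≤o _ _ d) ⊎-⇔ gap-stutter ψ (m⊔n≤o⇒n≤o _ _ d)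
  -- One step brings both gaps one position closer and uses up one level of `X`.
  gap-stutter (X φ) {suc n} (s≤s d) = mk⇔
    (from (gap-shift φ (suc (suc n)) 0) ∘ to   (gap-stutter φ d) ∘ to (gap-shift φ (suc n) 0))
    (from (gap-shift φ (suc n) 0) ∘ from (gap-stutter φ d) ∘ to (gap-shift φ (suc (suc n)) 0))
  gap-stutter (φ U ψ) {n} d = mk⇔ longer shorter
    where
    φ-stutter = gap-stutter φ (m⊔n≤o⇒m≤o _ _ d)
    ψ-stutter = gap-stutter ψ (m⊔n≤o⇒n≤o _ _ d)

    longer : gap (suc n) ⊢ φ U ψ → gap (suc (suc n)) ⊢ φ U ψ
    longer (zero  , _ , hψ , _)  = zero , z≤n , to ψ-stutter hψ , λ _ _ ()
    longer (suc l , _ , hψ , hφ) = suc (suc l) , z≤n , from (gap-shift ψ (suc n) (suc l)) hψ ,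
      λ { zero    _ _         → to φ-stutter (hφ 0 z≤n (s≤s z≤n))
        ; (suc k) _ (s≤s k<l) → from (gap-shift φ (suc n) k) (hφ k z≤n k<l) }

    shorter : gap (suc (suc n)) ⊢ φ U ψ → gap (suc n) ⊢ φ U ψ
    shorter (zero  , _ , hψ , _)  = zero , z≤n , from ψ-stutter hψ , λ _ _ ()
    shorter (suc l , _ , hψ , hφ) = l , z≤n , to (gap-shift ψ (suc n) l) hψ ,
      λ k _ k<l → to (gap-shift φ (suc n) k) (hφ (suc k) z≤n (s≤s k<l))
  gap-stutter (G φ) {n} d = mk⇔
    (λ { h zero    _ → to (gap-stutter φ d) (h 0 z≤n)
       ; h (suc k) _ → from (gap-shift φ (suc n) k) (h k z≤n) })
    (λ h k _ → to (gap-shift φ (suc n) k) (h (suc k) z≤n))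

  -- Subtracting 2 from both positions leaves either an odd number against 0 or 1 against a number
  -- at least 2.
  odd-gap-evenly : ∀ {e} d m → e ∈ gap (suc (d * 2)) (m * 2)
  odd-gap-evenly d       zero    = tt
  odd-gap-evenly zero    (suc m) = tt
  odd-gap-evenly {e} (suc d) (suc m) = odd-gap-evenly {e} d m

  gap-missing : ∀ {e} n → e ∉ gap n n
  gap-missing zero    ()
  gap-missing {e} (suc n) = gap-missing {e} n

  evenly-inexpressible : ∀ e → ¬ (∃ λ φ → ∀ σ → (σ ⊢ᴹ evenly e) ⇔ (σ ⊢ φ))
  evenly-inexpressible e (φ , equiv) = gap-missing {e} (suc d * 2) (even-gap (suc d))
    where
    -- Doubling fixes the parities: the gap at `suc (d * 2)` is odd, the following one is
    -- `suc d * 2`, and `d ≤ d * 2` meets the depth bound.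
    d = X-depth φ

    odd-gap : gap (suc (d * 2)) ⊢ φ
    odd-gap = to (equiv _) (from (evenly-⇔ e _) (odd-gap-evenly {e} d))

    even-gap : ∀ m → e ∈ gap (suc d * 2) (m * 2)
    even-gap = to (evenly-⇔ e _) (from (equiv _) (to (gap-stutter φ (m≤m*n d 2)) odd-gap))

theorem2 : (AP : Propositions) →
    ((φ : LTL AP) →
    ∃ λ (π : MTFormula AP) → (σ : Trace AP) → (σ ⊢ᴹ π) ⇔ (σ ⊢ φ))
    × (Propositions.P AP →
    ∃ λ (π : MTFormula AP) →
    ¬ (∃ λ (φ : LTL AP) → (σ : Trace AP) → (σ ⊢ᴹ π) ⇔ (σ ⊢ φ)))
theorem2 AP = (λ φ → embed φ , embed-⇔ φ) , (λ e → evenly e , evenly-inexpressible e)
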